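{- Let $k\ge 3$, $\varepsilon>0$, and let $f:S_k\to[k]$ be a social choice function on one voter satisfying $\mathbf{D}(f,\mathrm{NONMANIP}(1,k))\ge\varepsilon$. Let $\sigma\in S_k$ be uniformly random. Then $$\mathbb{P}(\sigma\in M(f))\ \ge\ \mathbb{P}(\sigma\in M_3(f))\ \ge\ \frac{\varepsilon^3}{10^5\,k^{16}}.$$
   Context: $[k]=\{1,\dots,k\}$ is the set of alternatives, $S_k$ the set of total orderings of $[k]$, and a social choice function (SCF) on $n$ voters is a map $f:S_k^n\to[k]$ (here $n=1$). Write $a\overset{\sigma_i}{>}b$ if the ranking $\sigma_i$ ranks $a$ above $b$. $\sigma\in S_k^n$ is a manipulation point of $f$ if there are $i\in[n]$ and $\sigma'$ differing from $\sigma$ only in coordinate $i$ with $f(\sigma')\overset{\sigma_i}{>}f(\sigma)$; it is an $r$-manipulation point if such $\sigma'$ exists with $\sigma'_i$ obtained from $\sigma_i$ by permuting at most $r$ alternatives occupying adjacent positions of $\sigma_i$. $M(f)$, $M_r(f)$ denote these sets. For nonempty $H\subseteq[k]$, $\mathrm{top}_H$ maps a ranking to its highest-ranked element of $H$. A SCF taking exactly two values $a,b$ is monotone if whenever $\sigma,\sigma'$ differ only in coordinate $i$ with $f(\sigma)=a,f(\sigma')=b$, then $a\overset{\sigma_i}{>}b$ and $b\overset{\sigma'_i}{>}a$. $\mathrm{NONMANIP}(n,k)$ is the set of SCFs which either equal $\sigma\mapsto\mathrm{top}_H(\sigma_i)$ for some $i\in[n]$ and nonempty $H\subseteq[k]$,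 or are monotone and take exactly two values. $\mathbf{D}(f,g)=\mathbb{P}(f(\sigma)\neq g(\sigma))$ for uniform $\sigma$, and $\mathbf{D}(f,G)=\min_{g\in G}\mathbf{D}(f,g)$. -}

module Defs where

open import Data.Nat as ℕ using (ℕ; zero; suc; _+_; _≤_; _<_)
open import Data.Nat.Properties as ℕP using ()
open import Data.Fin as Fin using (Fin; toℕ)
open import Data.Fin.Properties as FinP using (any?; all?)
open import Data.Fin.Subset using (Subset; _∈_; Nonempty)
open import Data.Vec as Vec using (Vec; []; _∷_; lookup; toList)
open import Data.List as List using (List; []; _∷_; length; filter; concatMap)
import Data.List.Membership.Propositional as LMem
open import Data.List.Relation.Unary.Any as Any using (Any)
open import Data.List.Relation.Unary.Unique.Propositional using (Unique)
import Data.List.Relation.Unary.Unique.DecPropositional as UDec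
open import Data.Product using (Σ; ∃; _×_; _,_)
open import Data.Sum using (_⊎_)
open import Data.Integer using (+_)
open import Data.Rational using (ℚ; 0ℚ; _/_)
open import Relation.Nullary using (¬_; Dec; yes; no; ¬?)
open import Relation.Nullary.Decidable using (_×-dec_; _⊎-dec_; _→-dec_)
open import Relation.Binary.PropositionalEquality using (_≡_; _≢_)

-- Rankings.  A ranking of [k] (alternatives Fin k) is a vector
-- σ : Vec (Fin k) k listing the alternatives from top (position 0) to
-- bottom, without repetition.  S_k is enumerated by filtering all
-- vectors for duplicate-freeness.

allVecs : (k m : ℕ) → List (Vec (Fin k) m)
allVecs k zero    = Vec.[] ∷ []
allVecs k (suc m) =
  concatMap (λ a → List.map (a Vec.∷_) (allVecs k m)) (List.allFin k)

IsRanking : {k : ℕ} → Vec (Fin k) k → Set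
IsRanking σ = Unique (toList σ)

isRanking? : {k : ℕ} (σ : Vec (Fin k) k) → Dec (IsRanking σ)
isRanking? {k} σ = UDec.unique? Fin._≟_ (toList σ)

rankings : (k : ℕ) → List (Vec (Fin k) k)
rankings k = filter isRanking? (allVecs k k)

Above : {k : ℕ} → Vec (Fin k) k → Fin k → Fin k → Set
Above {k} σ a b =
  ∃ λ (i : Fin k) → ∃ λ (j : Fin k) → (i Fin.< j) × (lookup σ i ≡ a) × (lookup σ j ≡ b)

above? : {k : ℕ} (σ : Vec (Fin k) k) (a b : Fin k) → Dec (Above σ a b)
above? σ a b = any? λ i → any? λ j →
  (i Fin.<? j) ×-dec ((lookup σ i Fin.≟ a) ×-dec (lookup σ j Fin.≟ b))

-- Social choice functions on one voter.  An SCF is given as a function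
-- on all vectors; only its values on rankings (elements of S_k) are ever
-- used below.

SCF : ℕ → Set
SCF k = Vec (Fin k) k → Fin k

-- σ' is obtained from σ by permuting the alternatives occupying the
-- (at most r) adjacent positions p, p+1, ..., p+r-1 of σ.
AdjPerm : {k : ℕ} (r : ℕ) (σ σ' : Vec (Fin k) k) → Set
AdjPerm {k} r σ σ' =
  ∃ λ (p : Fin k) → ∀ (i : Fin k) →
    (toℕ i < toℕ p ⊎ toℕ p + r ≤ toℕ i) → lookup σ' i ≡ lookup σ i

adjPerm? : {k : ℕ} (r : ℕ) (σ σ' : Vec (Fin k) k) → Dec (AdjPerm r σ σ')
adjPerm? r σ σ' = any? λ p → all? λ i →
  ((toℕ i ℕ.<? toℕ p) ⊎-dec (toℕ p + r ℕ.≤? toℕ i))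
    →-dec (lookup σ' i Fin.≟ lookup σ i)

ManipPoint : {k : ℕ} → SCF k → Vec (Fin k) k → Set
ManipPoint {k} f σ = Any (λ σ' → Above σ (f σ') (f σ)) (rankings k)

manipPoint? : {k : ℕ} (f : SCF k) (σ : Vec (Fin k) k) → Dec (ManipPoint f σ)
manipPoint? {k} f σ = Any.any? (λ σ' → above? σ (f σ') (f σ)) (rankings k)

ManipPointR : {k : ℕ} → ℕ → SCF k → Vec (Fin k) k → Set
ManipPointR {k} r f σ =
  Any (λ σ' → AdjPerm r σ σ' × Above σ (f σ') (f σ)) (rankings k)

manipPointR? : {k : ℕ} (r : ℕ) (f : SCF k) (σ : Vec (Fin k) k) →
               Dec (ManipPointR r f σ)
manipPointR? {k} r f σ =
  Any.any? (λ σ' → adjPerm? r σ σ' ×-dec above? σ (f σ') (f σ)) (rankings k)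

-- a / b as a rational (b = 0 never occurs below, since |S_k| = k! ≥ 1)
ratio : ℕ → ℕ → ℚ
ratio a zero    = 0ℚ
ratio a (suc b) = (+ a) / suc b

probManip : {k : ℕ} → SCF k → ℚ
probManip {k} f =
  ratio (length (filter (manipPoint? f) (rankings k))) (length (rankings k))

probManipR : {k : ℕ} → ℕ → SCF k → ℚ
probManipR {k} r f =
  ratio (length (filter (manipPointR? r f) (rankings k))) (length (rankings k))

dist : {k : ℕ} → SCF k → SCF k → ℚ
dist {k} f g =
  ratio (length (filter (λ σ → ¬? (f σ Fin.≟ g σ)) (rankings k)))
        (length (rankings k))

open LMem using () renaming (_∈_ to _∈ₗ_)

IsTop : {k : ℕ} → Subset k → Vec (Fin k) k → Fin k → Set
IsTop H σ x = (x ∈ H) × (∀ y → y ∈ H → y ≢ x → Above σ x y)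

IsTopH : {k : ℕ} → SCF k → Set
IsTopH {k} g =
  Σ (Subset k) λ H → Nonempty H × (∀ σ → σ ∈ₗ rankings k → IsTop H σ (g σ))

IsMonotoneTwoValued : {k : ℕ} → SCF k → Set
IsMonotoneTwoValued {k} g =
  ∃ λ (a : Fin k) → ∃ λ (b : Fin k) →
      (a ≢ b)
    × (∀ σ → σ ∈ₗ rankings k → (g σ ≡ a ⊎ g σ ≡ b))
    × (∃ λ σ → σ ∈ₗ rankings k × g σ ≡ a)
    × (∃ λ σ → σ ∈ₗ rankings k × g σ ≡ b)
    × (∀ σ σ' → σ ∈ₗ rankings k → σ' ∈ₗ rankings k →
         g σ ≡ a → g σ' ≡ b → Above σ a b × Above σ' b a)

NONMANIP : {k : ℕ} → SCF k → Set
NONMANIP g = IsTopH g ⊎ IsMonotoneTwoValued g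

{-# OPTIONS --safe #-}

-- A monotone one-voter SCF with exactly two values is some top_H, so it suffices to approximate f by
-- a top_H.  For an alternative a let C be the set of rankings σ such that f elects a once a is
-- raised to the top of σ.  If f(σ) = a, or if a is ranked above f(σ) in σ, then raising a by
-- adjacent swaps either leaves the outcome unchanged or meets a manipulation point.  So, up to
-- poly(k)·|M₃| rankings, {f = a} lies in C and {σ : a above f(σ)} lies in its complement.
-- A swap across the boundary of C also yields a manipulation point, with a on top, and a canonical
-- path argument over words of adjacent swaps gives |C|·|Cᶜ| ≤ k!·poly(k)·|M₃|.  Hence the smaller
-- of {f = a} and {σ : a above f(σ)} has square at most k!·poly(k)·|M₃|.  Take for H the a for which
-- the second is the smaller one: every σ with f(σ) ≠ top_H(σ) lies in the smaller set of some a.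
-- This gives ε² ≤ 4k⁶·P(M₃), and ε³ ≤ ε² since ε ≤ 1.

module Submission where

open import Defs
open import Data.Nat using (ℕ; _≤_; _^_; _*_)
open import Data.Product using (_×_)
import Data.Rational as Q

open import Data.Bool using (true)
open import Data.Fin as Fin using (Fin; zero; suc; toℕ; inject₁; fromℕ<; punchOut)
open import Data.Fin.Induction using (<-weakInduction)
import Data.Fin.Properties as FinP
open import Data.Fin.Subset using (Subset; Nonempty; ⁅_⁆) renaming (_∈_ to _∈ₛ_)
import Data.Fin.Subset.Properties as SubsetP
open import Data.Integer as ℤ using (+_)
import Data.Integer.Properties as ℤP
open import Data.List as List
  using (List; []; _∷_; _++_; length; filter; concatMap; cartesianProductWith; cartesianProduct)
open import Data.List.Membership.Propositional using (_∈_)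
import Data.List.Membership.Propositional.Properties as Mem
import Data.List.Properties as ListP
open import Data.List.Relation.Binary.Permutation.Propositional as Perm using (_↭_)
import Data.List.Relation.Binary.Permutation.Setoid.Properties as PermP
open import Data.List.Relation.Binary.Subset.Propositional using (_⊆_)
open import Data.List.Relation.Unary.All as All using (All; []; _∷_)
open import Data.List.Relation.Unary.AllPairs using ([]; _∷_)
open import Data.List.Relation.Unary.Any as Any using (here; there)
open import Data.List.Relation.Unary.Unique.Propositional using (Unique)
import Data.List.Relation.Unary.Unique.Propositional.Properties as UniqueP
open import Data.Nat using (zero; suc; _+_; _<_; _<?_; _≤?_; z≤n; s≤s; NonZero)
import Data.Nat.Properties as ℕP
open import Data.List.Extrema ℕP.≤-totalOrder using (argmax; f[xs]≤f[argmax])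
open import Data.Nat.Tactic.RingSolver using (solve-∀)
open import Data.Product using (∃; _,_; proj₁; proj₂)
import Data.Rational.Properties as QP
open import Data.Rational.Unnormalised as Qᵘ using (ℚᵘ; mkℚᵘ; *≤*)
import Data.Rational.Unnormalised.Properties as QᵘP
open import Data.Sum using (_⊎_; inj₁; inj₂)
open import Data.Unit using (tt)
open import Data.Vec as Vec
  using (Vec; []; _∷_; lookup; toList; insertAt; removeAt; tabulate)
open import Data.Vec.Membership.Propositional using () renaming (_∈_ to _∈ᵥ_)
import Data.Vec.Membership.Propositional.Properties as VecM
import Data.Vec.Properties as VecP
open import Data.Vec.Relation.Unary.Any as VecAny using (here; there)
import Data.Vec.Relation.Unary.Any.Properties as VecAnyP
open import Function using (_∘_; id)
open import Relation.Binary.Definitions using (tri<; tri≈; tri>)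
open import Relation.Binary.PropositionalEquality
  using (_≡_; _≢_; refl; sym; trans; cong; cong₂; subst; setoid)
open import Relation.Nullary using (¬_; ¬?; Dec; yes; no; contradiction)
open import Relation.Nullary.Decidable using (_×-dec_; does; dec-true)

private
  variable
    A B C : Set
    k m n : ℕ

-- Counting in lists.

-- Induction on `xs`: the head is cut out of `ys`, and the tail still embeds in the rest because
-- uniqueness keeps the head from recurring.
Unique-⊆⇒length≤ : {xs ys : List A} → Unique xs → xs ⊆ ys → length xs ≤ length ys
Unique-⊆⇒length≤ {xs = []} _ _ = z≤n
Unique-⊆⇒length≤ {xs = x ∷ xs} (x∉xs ∷ u) sub
  with Mem.∈-∃++ (sub (here refl))
... | ps , qs , refl =
  subst (suc (length xs) ≤_)
    (sym (trans (ListP.length-++ ps) (trans (ℕP.+-suc _ _) (cong suc (sym (ListP.length-++ ps))))))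
    (s≤s (Unique-⊆⇒length≤ u sub′))
  where
  sub′ : xs ⊆ ps ++ qs
  sub′ y∈xs with Mem.∈-++⁻ ps (sub (there y∈xs))
  ... | inj₁ y∈ps = Mem.∈-++⁺ˡ y∈ps
  ... | inj₂ (here refl) = contradiction refl (All.lookup x∉xs y∈xs)
  ... | inj₂ (there y∈qs) = Mem.∈-++⁺ʳ ps y∈qs

length-concatMap≤ : (g : A → List B) (b : ℕ) → (∀ x → length (g x) ≤ b) →
                    ∀ xs → length (concatMap g xs) ≤ length xs * b
length-concatMap≤ g b le [] = z≤n
length-concatMap≤ g b le (x ∷ xs) = subst (_≤ b + length xs * b)
  (sym (ListP.length-++ (g x)))
  (ℕP.+-mono-≤ (le x) (length-concatMap≤ g b le xs))

length-cartesianProductWith : (g : A → B → C) (xs : List A) (ys : List B) →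
  length (cartesianProductWith g xs ys) ≡ length xs * length ys
length-cartesianProductWith g [] ys = refl
length-cartesianProductWith g (x ∷ xs) ys = trans (ListP.length-++ (List.map (g x) ys))
  (cong₂ _+_ (ListP.length-map (g x) ys) (length-cartesianProductWith g xs ys))

-- Rankings and their enumeration.

lookup-injective : (σ : Vec A n) → Unique (toList σ) →
                   ∀ {i j} → lookup σ i ≡ lookup σ j → i ≡ j
lookup-injective (x ∷ σ) _ {zero} {zero} _ = refl
lookup-injective (x ∷ σ) (x∉ ∷ _) {zero} {suc j} eq =
  contradiction eq (All.lookup x∉ (VecM.∈-toList⁺ (VecM.∈-lookup j σ)))
lookup-injective (x ∷ σ) (x∉ ∷ _) {suc i} {zero} eq =
  contradiction (sym eq) (All.lookup x∉ (VecM.∈-toList⁺ (VecM.∈-lookup i σ)))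
lookup-injective (x ∷ σ) (_ ∷ u) {suc i} {suc j} eq = cong suc (lookup-injective σ u eq)

-- Pigeonhole: if `x` were missed, punching it out of the values would inject `Fin (suc k)` into
-- `Fin k`.
ranking-surjective : (σ : Vec (Fin k) k) → IsRanking σ → ∀ x → ∃ λ i → lookup σ i ≡ x
ranking-surjective {suc k} σ u x with FinP.any? (λ i → lookup σ i Fin.≟ x)
... | yes found = found
... | no missed = contradiction (λ {i} {j} → injective {i} {j}) (FinP.<⇒notInjective (ℕP.n<1+n k))
  where
  x≢ : ∀ i → x ≢ lookup σ i
  x≢ i eq = missed (i , sym eq)
  injective : ∀ {i j} → punchOut (x≢ i) ≡ punchOut (x≢ j) → i ≡ j
  injective eq = lookup-injective σ u (FinP.punchOut-injective (x≢ _) (x≢ _) eq)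

allVecs≡cartesianProductWith : ∀ k m → allVecs k (suc m) ≡
  cartesianProductWith _∷_ (List.allFin k) (allVecs k m)
allVecs≡cartesianProductWith k m = go (List.allFin k)
  where
  go : ∀ xs → concatMap (λ a → List.map (a ∷_) (allVecs k m)) xs ≡
              cartesianProductWith _∷_ xs (allVecs k m)
  go [] = refl
  go (x ∷ xs) = cong (List.map (x ∷_) (allVecs k m) ++_) (go xs)

∈-allVecs : (v : Vec (Fin k) m) → v ∈ allVecs k m
∈-allVecs [] = here refl
∈-allVecs {k} {suc m} (x ∷ v) rewrite allVecs≡cartesianProductWith k m =
  Mem.∈-cartesianProductWith⁺ _∷_ (Mem.∈-allFin x) (∈-allVecs v)

allVecs-unique : ∀ k m → Unique (allVecs k m)
allVecs-unique k zero = [] ∷ []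
allVecs-unique k (suc m) rewrite allVecs≡cartesianProductWith k m =
  UniqueP.cartesianProductWith⁺ _∷_ VecP.∷-injective (UniqueP.allFin⁺ k) (allVecs-unique k m)

rankings-unique : ∀ k → Unique (rankings k)
rankings-unique k = UniqueP.filter⁺ isRanking? (allVecs-unique k k)

∈-rankings⁺ : {σ : Vec (Fin k) k} → IsRanking σ → σ ∈ rankings k
∈-rankings⁺ u = Mem.∈-filter⁺ isRanking? (∈-allVecs _) u

∈-rankings⁻ : {σ : Vec (Fin k) k} → σ ∈ rankings k → IsRanking σ
∈-rankings⁻ {k} σ∈ = proj₂ (Mem.∈-filter⁻ isRanking? {xs = allVecs k k} σ∈)

-- Relative order in a ranking.

-- An inductive form of `Above`, which can be followed by recursion through insertions and swaps.
data Precedes {A : Set} (x y : A) : Vec A n → Set where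
  here  : {σ : Vec A n} → y ∈ᵥ σ → Precedes x y (x ∷ σ)
  there : {z : A} {σ : Vec A n} → Precedes x y σ → Precedes x y (z ∷ σ)

lookup⇒Precedes : (σ : Vec A n) {i j : Fin n} → i Fin.< j → Precedes (lookup σ i) (lookup σ j) σ
lookup⇒Precedes (x ∷ σ) {zero} {suc j} _ = here (VecM.∈-lookup j σ)
lookup⇒Precedes (x ∷ σ) {suc i} {suc j} (s≤s i<j) = there (lookup⇒Precedes σ i<j)

Above⇒Precedes : {σ : Vec (Fin k) k} {x y : Fin k} → Above σ x y → Precedes x y σ
Above⇒Precedes {σ = σ} (i , j , i<j , refl , refl) = lookup⇒Precedes σ i<j

Precedes⇒lookup : {x y : A} {σ : Vec A n} → Precedes x y σ →
                  ∃ λ i → ∃ λ j → (i Fin.< j) × (lookup σ i ≡ x) × (lookup σ j ≡ y)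
Precedes⇒lookup (here y∈σ) =
  zero , suc (VecAny.index y∈σ) , s≤s z≤n , refl , sym (VecAnyP.lookup-index y∈σ)
Precedes⇒lookup (there p) with Precedes⇒lookup p
... | i , j , i<j , eqᵢ , eqⱼ = suc i , suc j , s≤s i<j , eqᵢ , eqⱼ

Precedes⇒Above : {σ : Vec (Fin k) k} {x y : Fin k} → Precedes x y σ → Above σ x y
Precedes⇒Above = Precedes⇒lookup

Above-total : (σ : Vec (Fin k) k) → IsRanking σ → ∀ {x y} → x ≢ y → Above σ x y ⊎ Above σ y x
Above-total σ u {x} {y} x≢y with ranking-surjective σ u x | ranking-surjective σ u y
... | i , refl | j , refl with FinP.<-cmp i j
... | tri< i<j _ _ = inj₁ (i , j , i<j , refl , refl)
... | tri≈ _ refl _ = contradiction refl x≢y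
... | tri> _ _ j<i = inj₂ (j , i , j<i , refl , refl)

-- Adjacent swaps.

-- Swaps positions i and i + 1, and does nothing when i + 1 is not a position.
swapAt : ℕ → Vec A n → Vec A n
swapAt zero (x ∷ y ∷ σ) = y ∷ x ∷ σ
swapAt (suc i) (x ∷ σ) = x ∷ swapAt i σ
swapAt _ σ = σ

swapAt-involutive : ∀ i (σ : Vec A n) → swapAt i (swapAt i σ) ≡ σ
swapAt-involutive zero [] = refl
swapAt-involutive zero (x ∷ []) = refl
swapAt-involutive zero (x ∷ y ∷ σ) = refl
swapAt-involutive (suc i) [] = refl
swapAt-involutive (suc i) (x ∷ σ) = cong (x ∷_) (swapAt-involutive i σ)

swapAt-map : (g : A → B) → ∀ i (σ : Vec A n) → swapAt i (Vec.map g σ) ≡ Vec.map g (swapAt i σ)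
swapAt-map g zero [] = refl
swapAt-map g zero (x ∷ []) = refl
swapAt-map g zero (x ∷ y ∷ σ) = refl
swapAt-map g (suc i) [] = refl
swapAt-map g (suc i) (x ∷ σ) = cong (g x ∷_) (swapAt-map g i σ)

swapAt-↭ : ∀ i (σ : Vec A n) → toList σ ↭ toList (swapAt i σ)
swapAt-↭ zero [] = Perm.refl
swapAt-↭ zero (x ∷ []) = Perm.refl
swapAt-↭ zero (x ∷ y ∷ σ) = Perm.swap x y Perm.refl
swapAt-↭ (suc i) [] = Perm.refl
swapAt-↭ (suc i) (x ∷ σ) = Perm.prep x (swapAt-↭ i σ)

lookup-swapAt : ∀ i (σ : Vec A n) j → (toℕ j < i ⊎ 2 + i ≤ toℕ j) →
                lookup (swapAt i σ) j ≡ lookup σ j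
lookup-swapAt zero (x ∷ []) j _ = refl
lookup-swapAt zero (x ∷ y ∷ σ) (suc (suc j)) _ = refl
lookup-swapAt zero (x ∷ y ∷ σ) zero (inj₂ ())
lookup-swapAt zero (x ∷ y ∷ σ) (suc zero) (inj₂ (s≤s ()))
lookup-swapAt (suc i) (x ∷ σ) zero _ = refl
lookup-swapAt (suc i) (x ∷ σ) (suc j) (inj₁ (s≤s j<i)) = lookup-swapAt i σ j (inj₁ j<i)
lookup-swapAt (suc i) (x ∷ σ) (suc j) (inj₂ (s≤s i≤j)) = lookup-swapAt i σ j (inj₂ i≤j)

Unique-resp-↭ : {xs ys : List A} → xs ↭ ys → Unique xs → Unique ys
Unique-resp-↭ p = PermP.Unique-resp-↭ (setoid _) (Perm.↭⇒↭ₛ p)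

swapAt-ranking : ∀ i {σ : Vec (Fin k) k} → IsRanking σ → IsRanking (swapAt i σ)
swapAt-ranking i {σ} = Unique-resp-↭ (swapAt-↭ i σ)

-- The two moved positions lie in the window of three that starts at `i`. An `i` past the last
-- position moves nothing, and the window at `zero` serves.
swapAt-AdjPerm : ∀ i (σ : Vec (Fin (suc k)) (suc k)) → AdjPerm 3 σ (swapAt i σ)
swapAt-AdjPerm {k} i σ with i <? suc k
... | yes i<k = fromℕ< i<k , λ j out → lookup-swapAt i σ j (far j out)
  where
  far : ∀ j → (toℕ j < toℕ (fromℕ< i<k) ⊎ toℕ (fromℕ< i<k) + 3 ≤ toℕ j) →
        toℕ j < i ⊎ 2 + i ≤ toℕ j
  far j out rewrite FinP.toℕ-fromℕ< i<k with out
  ... | inj₁ j<i = inj₁ j<i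
  ... | inj₂ le = inj₂ (ℕP.≤-trans (ℕP.n≤1+n _) (subst (_≤ toℕ j) (ℕP.+-comm i 3) le))
... | no i≮k = zero , λ j _ →
  lookup-swapAt i σ j (inj₁ (ℕP.<-≤-trans (FinP.toℕ<n j) (ℕP.≮⇒≥ i≮k)))

-- Words of adjacent swaps.

act : List ℕ → Vec A n → Vec A n
act [] σ = σ
act (i ∷ w) σ = act w (swapAt i σ)

act-++ : ∀ w w′ (σ : Vec A n) → act (w ++ w′) σ ≡ act w′ (act w σ)
act-++ [] w′ σ = refl
act-++ (i ∷ w) w′ σ = act-++ w w′ (swapAt i σ)

act-map : (g : A → B) → ∀ w (σ : Vec A n) → act w (Vec.map g σ) ≡ Vec.map g (act w σ)
act-map g [] σ = refl
act-map g (i ∷ w) σ = trans (cong (act w) (swapAt-map g i σ)) (act-map g w (swapAt i σ))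

act-shift : ∀ w (x : A) (σ : Vec A n) → act (List.map suc w) (x ∷ σ) ≡ x ∷ act w σ
act-shift [] x σ = refl
act-shift (i ∷ w) x σ = act-shift w x (swapAt i σ)

-- The swaps p - 1, ..., 1, 0 in this order: the entry at p bubbles to the front and the others keep
-- their order.
raise : Fin n → List ℕ
raise zero = []
raise (suc p) = List.map suc (raise p) ++ 0 ∷ []

length-raise : (p : Fin n) → length (raise p) ≡ toℕ p
length-raise zero = refl
length-raise (suc p) = trans (ListP.length-++ (List.map suc (raise p)))
  (trans (ℕP.+-comm _ 1) (cong suc (trans (ListP.length-map suc (raise p)) (length-raise p))))

act-raise : ∀ p (σ : Vec A (suc n)) → act (raise p) σ ≡ lookup σ p ∷ removeAt σ p
act-raise zero (x ∷ σ) = refl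
act-raise (suc p) (x ∷ y ∷ σ) =
  trans (act-++ (List.map suc (raise p)) (0 ∷ []) (x ∷ y ∷ σ))
    (cong (swapAt 0) (trans (act-shift (raise p) x (y ∷ σ)) (cong (x ∷_) (act-raise p (y ∷ σ)))))

-- Selection sort: the first entry of `τ` is raised to the front, at the cost of at most n swaps,
-- and the remaining entries are sorted behind it. They differ from that first entry, so they still
-- occur after its removal.
sorting-word : (σ τ : Vec A n) → Unique (toList τ) → (∀ i → ∃ λ j → lookup σ j ≡ lookup τ i) →
               ∃ λ w → length w ≤ n * n × act w σ ≡ τ
sorting-word [] [] _ _ = [] , z≤n , refl
sorting-word {n = suc n} σ (t ∷ τ) (t∉τ ∷ u) occurs with occurs zero
... | p , refl with sorting-word (removeAt σ p) τ u occurs′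
  where
  occurs′ : ∀ i → ∃ λ j → lookup (removeAt σ p) j ≡ lookup τ i
  occurs′ i with occurs (suc i)
  ... | j , eq = punchOut p≢j , trans (VecP.removeAt-punchOut σ p≢j) eq
    where
    p≢j : p ≢ j
    p≢j refl = contradiction eq (All.lookup t∉τ (VecM.∈-toList⁺ (VecM.∈-lookup i τ)))
... | w , le , eq = raise p ++ List.map suc w , bound , reaches
  where
  reaches : act (raise p ++ List.map suc w) σ ≡ lookup σ p ∷ τ
  reaches = trans (act-++ (raise p) _ σ) (trans (cong (act (List.map suc w)) (act-raise p σ))
    (trans (act-shift w _ _) (cong (lookup σ p ∷_) eq)))
  bound : length (raise p ++ List.map suc w) ≤ suc n * suc n
  bound = subst (_≤ suc n * suc n)
    (sym (trans (ListP.length-++ (raise p))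
      (cong₂ _+_ (length-raise p) (ListP.length-map suc w))))
    (ℕP.+-mono-≤ (ℕP.<⇒≤ (FinP.toℕ<n p)) (ℕP.≤-trans le (ℕP.*-monoʳ-≤ n (ℕP.n≤1+n n))))

reachable : (ρ : Vec (Fin k) k) → IsRanking ρ →
            ∃ λ w → length w ≤ k * k × act w (Vec.allFin k) ≡ ρ
reachable ρ u = sorting-word (Vec.allFin _) ρ u (λ i → lookup ρ i , VecP.lookup-allFin _)

-- Fixing one word per ranking keeps the number of canonical words down to k!. The empty word
-- elsewhere makes the length bound hold for all vectors.
word : Vec (Fin k) k → List ℕ
word ρ with isRanking? ρ
... | yes u = proj₁ (reachable ρ u)
... | no _ = []

length-word : (ρ : Vec (Fin k) k) → length (word ρ) ≤ k * k
length-word ρ with isRanking? ρ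
... | yes u = proj₁ (proj₂ (reachable ρ u))
... | no _ = z≤n

act-word : (ρ : Vec (Fin k) k) → IsRanking ρ → act (word ρ) (Vec.allFin k) ≡ ρ
act-word ρ u with isRanking? ρ
... | yes u′ = proj₂ (proj₂ (reachable ρ u′))
... | no ¬u = contradiction u ¬u

map-toList : (g : A → B) (σ : Vec A n) → toList (Vec.map g σ) ≡ List.map g (toList σ)
map-toList g [] = refl
map-toList g (x ∷ σ) = cong (g x ∷_) (map-toList g σ)

-- The words are indexed by rankings: relabelling by σ reduces the journey from σ to τ to the
-- one from the identity to σ⁻¹τ, because position swaps commute with relabelling.
word-between : (σ τ : Vec (Fin k) k) → IsRanking σ → IsRanking τ →
               ∃ λ ρ → ρ ∈ rankings k × act (word ρ) σ ≡ τ
word-between {k} σ τ uσ uτ = ρ , ∈-rankings⁺ uρ , reaches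
  where
  position : ∀ x → ∃ λ i → lookup σ i ≡ x
  position = ranking-surjective σ uσ
  ρ : Vec (Fin k) k
  ρ = Vec.map (λ x → proj₁ (position x)) τ
  relabel : Vec.map (lookup σ) ρ ≡ τ
  relabel = trans (sym (VecP.map-∘ _ _ τ))
    (trans (VecP.map-cong (λ x → proj₂ (position x)) τ) (VecP.map-id τ))
  uρ : IsRanking ρ
  uρ = UniqueP.map⁻ {f = lookup σ}
    (subst Unique (trans (cong toList (sym relabel)) (map-toList (lookup σ) ρ)) uτ)
  reaches : act (word ρ) σ ≡ τ
  reaches = trans (cong (act (word ρ)) (sym (VecP.map-lookup-allFin σ)))
    (trans (act-map (lookup σ) (word ρ) _) (trans (cong (Vec.map (lookup σ)) (act-word ρ uρ)) relabel))

-- Moving one alternative through a fixed order of the others.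

insertAt-↭ : (v : Vec A n) (p : Fin (suc n)) (x : A) → x ∷ toList v ↭ toList (insertAt v p x)
insertAt-↭ v zero x = Perm.refl
insertAt-↭ (y ∷ v) (suc p) x = Perm.trans (Perm.swap x y Perm.refl) (Perm.prep y (insertAt-↭ v p x))

swapAt-raises : (v : Vec A n) (q : Fin n) (x : A) →
                swapAt (toℕ q) (insertAt v (suc q) x) ≡ insertAt v (inject₁ q) x
swapAt-raises (y ∷ v) zero x = refl
swapAt-raises (y ∷ v) (suc q) x = cong (y ∷_) (swapAt-raises v q x)

∈-insertAt⁻ : (v : Vec A n) (p : Fin (suc n)) {x y : A} → y ∈ᵥ insertAt v p x → y ≡ x ⊎ y ∈ᵥ v
∈-insertAt⁻ v zero (here y≡x) = inj₁ y≡x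
∈-insertAt⁻ v zero (there y∈) = inj₂ y∈
∈-insertAt⁻ (z ∷ v) (suc p) (here y≡z) = inj₂ (here y≡z)
∈-insertAt⁻ (z ∷ v) (suc p) (there y∈) with ∈-insertAt⁻ v p y∈
... | inj₁ y≡x = inj₁ y≡x
... | inj₂ y∈v = inj₂ (there y∈v)

∈-insertAt⁺ : (v : Vec A n) (p : Fin (suc n)) {x y : A} → y ∈ᵥ v → y ∈ᵥ insertAt v p x
∈-insertAt⁺ v zero y∈ = there y∈
∈-insertAt⁺ (z ∷ v) (suc p) (here y≡z) = here y≡z
∈-insertAt⁺ (z ∷ v) (suc p) (there y∈) = there (∈-insertAt⁺ v p y∈)

-- Raising `a` by one place reverses a single pair, in which `a` was the lower member; `y ≢ a`
-- excludes that pair.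
Precedes-raise : (v : Vec A n) (q : Fin n) {a x y : A} → y ≢ a →
                 Precedes x y (insertAt v (suc q) a) → Precedes x y (insertAt v (inject₁ q) a)
Precedes-raise (z ∷ v) zero y≢a (here (here y≡a)) = contradiction y≡a y≢a
Precedes-raise (z ∷ v) zero y≢a (here (there y∈v)) = there (here y∈v)
Precedes-raise (z ∷ v) zero y≢a (there (here y∈v)) = here (there y∈v)
Precedes-raise (z ∷ v) zero y≢a (there (there p)) = there (there p)
Precedes-raise (z ∷ v) (suc q) y≢a (here y∈) with ∈-insertAt⁻ v (suc q) y∈
... | inj₁ y≡a = contradiction y≡a y≢a
... | inj₂ y∈v = here (∈-insertAt⁺ v (inject₁ q) y∈v)
Precedes-raise (z ∷ v) (suc q) y≢a (there p) = there (Precedes-raise v q y≢a p)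

-- Either the swap involves `x`, and the order `v` of the others is untouched, or it acts within `v`
-- and `x` stays in place.
swapAt-insertAt : ∀ i (v : Vec A n) (p : Fin (suc n)) (x : A) →
  (∃ λ p′ → swapAt i (insertAt v p x) ≡ insertAt v p′ x) ⊎
  (∃ λ j → swapAt i (insertAt v p x) ≡ insertAt (swapAt j v) p x)
swapAt-insertAt zero [] zero x = inj₁ (zero , refl)
swapAt-insertAt zero (y ∷ v) zero x = inj₁ (suc zero , refl)
swapAt-insertAt (suc i) v zero x = inj₂ (i , refl)
swapAt-insertAt zero (y ∷ v) (suc zero) x = inj₁ (zero , refl)
swapAt-insertAt zero (y ∷ z ∷ v) (suc (suc p)) x = inj₂ (zero , refl)
swapAt-insertAt (suc i) (y ∷ v) (suc p) x with swapAt-insertAt i v p x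
... | inj₁ (p′ , eq) = inj₁ (suc p′ , cong (y ∷_) eq)
... | inj₂ (j , eq) = inj₂ (suc j , cong (y ∷_) eq)

-- Canonical paths and their crossings.

-- A split (d , w′) of w records how to return from an intermediate point and how to go on.
splits : List ℕ → List ℕ → List (List ℕ × List ℕ)
splits d [] = []
splits d (i ∷ w) = (i ∷ d , w) ∷ splits (i ∷ d) w

length-splits : ∀ d w → length (splits d w) ≡ length w
length-splits d [] = refl
length-splits d (i ∷ w) = cong suc (length-splits (i ∷ d) w)

-- Follow `w` until `P` first fails. The swaps made so far accumulate in reverse in `d`, and swaps
-- are involutions, so the split and `ρ′` together determine both ends of the path. This is what
-- makes the later count injective.
crossing : {P : Vec (Fin k) k → Set} → (∀ σ → Dec (P σ)) → ∀ d w {ρ} → IsRanking ρ →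
  P ρ → ¬ P (act w ρ) →
  ∃ λ s → s ∈ splits d w × ∃ λ ρ′ → IsRanking ρ′ × ¬ P ρ′ × (∃ λ i → P (swapAt i ρ′)) ×
    act (proj₁ s) ρ′ ≡ act d ρ × act (proj₂ s) ρ′ ≡ act w ρ
crossing P? d [] u pρ ¬p = contradiction pρ ¬p
crossing {P = P} P? d (i ∷ w) {ρ} u pρ ¬p with P? (swapAt i ρ)
... | no ¬p′ = (i ∷ d , w) , here refl , swapAt i ρ , swapAt-ranking i u , ¬p′ ,
  (i , subst P (sym (swapAt-involutive i ρ)) pρ) , cong (act d) (swapAt-involutive i ρ) , refl
... | yes p′ with crossing P? (i ∷ d) w (swapAt-ranking i u) p′ ¬p
... | s , s∈ , ρ′ , u′ , ¬p″ , edge , back , forth =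
  s , there s∈ , ρ′ , u′ , ¬p″ , edge , trans back (cong (act d) (swapAt-involutive i ρ)) , forth

-- Manipulation points met while raising an alternative.

module Voter {k : ℕ} (f : SCF (suc k)) where

  K : ℕ
  K = suc k

  Ranking : Set
  Ranking = Vec (Fin K) K

  manipulable : List Ranking
  manipulable = filter (manipPointR? 3 f) (rankings K)

  N M : ℕ
  N = length (rankings K)
  M = length manipulable

  swap-manipulates : ∀ i {σ} → IsRanking σ → Above σ (f (swapAt i σ)) (f σ) → σ ∈ manipulable
  swap-manipulates i {σ} u above = Mem.∈-filter⁺ (manipPointR? 3 f) (∈-rankings⁺ u)
    (Any.map (λ { refl → swapAt-AdjPerm i σ , above }) (∈-rankings⁺ (swapAt-ranking i u)))

  -- Contains every ranking that becomes a manipulation point when `a` alone is moved. Both the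
  -- deleted and the new position range over all of `Fin K`, whence the factor `K * K`.
  nearby : Fin K → List Ranking
  nearby a = cartesianProductWith (λ σ qp → insertAt (removeAt σ (proj₁ qp)) (proj₂ qp) a)
    manipulable (cartesianProduct (List.allFin K) (List.allFin K))

  ∈-nearby : {a : Fin K} {v : Vec (Fin K) k} (p q : Fin K) →
             insertAt v q a ∈ manipulable → insertAt v p a ∈ nearby a
  ∈-nearby {a} {v} p q hit =
    subst (λ v′ → insertAt v′ p a ∈ nearby a) (VecP.removeAt-insertAt v q a)
      (Mem.∈-cartesianProductWith⁺ _ hit
        (Mem.∈-cartesianProduct⁺ (Mem.∈-allFin q) (Mem.∈-allFin p)))

  length-nearby : ∀ a → length (nearby a) ≡ M * (K * K)
  length-nearby a = trans (length-cartesianProductWith _ manipulable _)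
    (cong (M *_) (trans (length-cartesianProductWith _,_ (List.allFin K) (List.allFin K))
      (cong (λ l → l * l) (ListP.length-tabulate {n = K} id))))

  -- Induction on the position of `a`, comparing the rankings before and after one raise. If the
  -- outcome stays the same, `a` remains weakly above it and the induction hypothesis applies; if it
  -- changes, one of the two rankings is a manipulation point.
  climb : ∀ a v → IsRanking (a ∷ v) → ∀ p →
    (f (insertAt v p a) ≡ a ⊎ Above (insertAt v p a) a (f (insertAt v p a))) →
    f (a ∷ v) ≡ f (insertAt v p a) ⊎ ∃ λ q → insertAt v q a ∈ manipulable
  climb a v u = <-weakInduction P (λ _ → inj₁ refl) step
    where
    σ : Fin K → Ranking
    σ p = insertAt v p a
    P : Fin K → Set
    P p = (f (σ p) ≡ a ⊎ Above (σ p) a (f (σ p))) →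
          f (a ∷ v) ≡ f (σ p) ⊎ ∃ λ q → σ q ∈ manipulable
    uσ : ∀ p → IsRanking (σ p)
    uσ p = Unique-resp-↭ (insertAt-↭ v p a) u
    raised : ∀ q → swapAt (toℕ q) (σ (suc q)) ≡ σ (inject₁ q)
    raised q = swapAt-raises v q a
    lowered : ∀ q → swapAt (toℕ q) (σ (inject₁ q)) ≡ σ (suc q)
    lowered q = trans (cong (swapAt (toℕ q)) (sym (raised q))) (swapAt-involutive (toℕ q) _)
    upper : ∀ q → Above (σ (inject₁ q)) (f (σ (suc q))) (f (σ (inject₁ q))) →
            σ (inject₁ q) ∈ manipulable
    upper q above = swap-manipulates (toℕ q) (uσ _)
      (subst (λ τ → Above (σ (inject₁ q)) (f τ) (f (σ (inject₁ q)))) (sym (lowered q)) above)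
    lower : ∀ q → Above (σ (suc q)) (f (σ (inject₁ q))) (f (σ (suc q))) →
            σ (suc q) ∈ manipulable
    lower q above = swap-manipulates (toℕ q) (uσ _)
      (subst (λ τ → Above (σ (suc q)) (f τ) (f (σ (suc q)))) (sym (raised q)) above)
    keep : ∀ q {x y} → y ≢ a → Above (σ (suc q)) x y → Above (σ (inject₁ q)) x y
    keep q y≢a = Precedes⇒Above ∘ Precedes-raise v q y≢a ∘ Above⇒Precedes
    keep-weakly : ∀ q {x} → x ≡ a ⊎ Above (σ (suc q)) a x → x ≡ a ⊎ Above (σ (inject₁ q)) a x
    keep-weakly q (inj₁ eq) = inj₁ eq
    keep-weakly q {x} (inj₂ above) with x Fin.≟ a
    ... | yes eq = inj₁ eq
    ... | no x≢a = inj₂ (keep q x≢a above)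
    step : ∀ q → P (inject₁ q) → P (suc q)
    step q ih weakly with f (σ (inject₁ q)) Fin.≟ f (σ (suc q))
    step q ih weakly | yes same
      with ih (subst (λ c → c ≡ a ⊎ Above (σ (inject₁ q)) a c) (sym same) (keep-weakly q weakly))
    ... | inj₁ eq = inj₁ (trans eq same)
    ... | inj₂ hit = inj₂ hit
    step q ih weakly | no change with f (σ (inject₁ q)) Fin.≟ a | weakly
    ... | yes c≡a | inj₁ u≡a = contradiction (trans c≡a (sym u≡a)) change
    -- Raising `a` makes it win, and the voter already prefers `a` to the old outcome.
    ... | yes c≡a | inj₂ above =
      inj₂ (suc q , lower q (subst (λ c → Above (σ (suc q)) c (f (σ (suc q)))) (sym c≡a) above))
    -- If the lower ranking prefers the new outcome, raising `a` manipulates there. Otherwise it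
    -- prefers the old one; since the new outcome is not `a`, this preference survives the raise,
    -- and lowering `a` again manipulates from the upper ranking.
    ... | no c≢a | _ with Above-total (σ (suc q)) (uσ _) change
    ... | inj₁ above = inj₂ (suc q , lower q above)
    ... | inj₂ above = inj₂ (inject₁ q , upper q (keep q c≢a above))

  -- Isoperimetry of the set C.

  -- Membership in C. Quantifying over `p` makes this decidable on every vector; on a ranking `p` is
  -- unique.
  WinsOnTop : Fin K → Ranking → Set
  WinsOnTop a σ = ∃ λ p → lookup σ p ≡ a × f (a ∷ removeAt σ p) ≡ a

  winsOnTop? : ∀ a σ → Dec (WinsOnTop a σ)
  winsOnTop? a σ = FinP.any? λ p → (lookup σ p Fin.≟ a) ×-dec (f (a ∷ removeAt σ p) Fin.≟ a)

  winsOnTop⁺ : {a : Fin K} {v : Vec (Fin K) k} (p : Fin K) → f (a ∷ v) ≡ a → WinsOnTop a (insertAt v p a)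
  winsOnTop⁺ {a} {v} p eq = p , VecP.insertAt-lookup v p a ,
    subst (λ v′ → f (a ∷ v′) ≡ a) (sym (VecP.removeAt-insertAt v p a)) eq

  winsOnTop⁻ : {a : Fin K} {v : Vec (Fin K) k} (p : Fin K) →
               IsRanking (insertAt v p a) → WinsOnTop a (insertAt v p a) →
               f (a ∷ v) ≡ a
  winsOnTop⁻ {a} {v} p u (p′ , at , eq)
    with refl ← lookup-injective (insertAt v p a) u {p} {p′}
                  (trans (VecP.insertAt-lookup v p a) (sym at)) =
    subst (λ v′ → f (a ∷ v′) ≡ a) (VecP.removeAt-insertAt v p a) eq

  split-at : (a : Fin K) (σ : Ranking) → IsRanking σ → ∃ λ p → ∃ λ v → σ ≡ insertAt v p a
  split-at a σ u with ranking-surjective σ u a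
  ... | p , refl = p , removeAt σ p , sym (VecP.insertAt-removeAt σ p)

  to-top : {a : Fin K} {v : Vec (Fin K) k} (p : Fin K) → IsRanking (insertAt v p a) → IsRanking (a ∷ v)
  to-top {a} {v} p = Unique-resp-↭ (Perm.↭-sym (insertAt-↭ v p a))

  top-above : {a b : Fin K} {v : Vec (Fin K) k} → IsRanking (a ∷ v) → b ≢ a → Above (a ∷ v) a b
  top-above {a} {b} {v} u b≢a with ranking-surjective (a ∷ v) u b
  ... | zero , eq = contradiction (sym eq) b≢a
  ... | suc i , eq = zero , suc i , s≤s z≤n , refl , eq

  -- A swap that involves `a` leaves the order of the others alone, so it cannot change membership
  -- in C. Any other swap, performed with `a` moved to the top, changes the outcome to the favourite
  -- `a` and so manipulates there.
  boundary : ∀ a i {ρ} → IsRanking ρ → ¬ WinsOnTop a ρ → WinsOnTop a (swapAt i ρ) → ρ ∈ nearby a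
  boundary a i {ρ} u ¬wins wins with split-at a ρ u
  ... | p , v , refl with swapAt-insertAt i v p a
  ... | inj₁ (p′ , eq) = contradiction
    (winsOnTop⁺ p (winsOnTop⁻ p′ (subst IsRanking eq (swapAt-ranking i u))
      (subst (WinsOnTop a) eq wins))) ¬wins
  ... | inj₂ (j , eq) = ∈-nearby p zero
    (swap-manipulates (suc j) (to-top p u)
      (subst (λ c → Above (a ∷ v) c (f (a ∷ v))) (sym after)
        (top-above (to-top p u) (¬wins ∘ winsOnTop⁺ p))))
    where
    after : f (a ∷ swapAt j v) ≡ a
    after = winsOnTop⁻ p (subst IsRanking eq (swapAt-ranking i u)) (subst (WinsOnTop a) eq wins)

  winning losing chosen beaten : Fin K → List Ranking
  winning a = filter (winsOnTop? a) (rankings K)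
  losing a = filter (¬? ∘ winsOnTop? a) (rankings K)
  chosen a = filter (λ σ → f σ Fin.≟ a) (rankings K)
  beaten a = filter (λ σ → above? σ a (f σ)) (rankings K)

  filter-unique : {P : Ranking → Set} (P? : ∀ σ → Dec (P σ)) → Unique (filter P? (rankings K))
  filter-unique P? = UniqueP.filter⁺ P? (rankings-unique K)

  -- The canonical path from a winning `σ` to a losing `τ` leaves C at some ranking in `nearby a`.
  -- That ranking and the split of the word recover the pair, and there are `N` words with at most
  -- `K * K` splits each.
  isoperimetry : ∀ a → length (winning a) * length (losing a) ≤ N * (K * K) * length (nearby a)
  isoperimetry a = begin
    length (winning a) * length (losing a)
      ≡⟨ sym (length-cartesianProductWith _,_ (winning a) (losing a)) ⟩
    length (cartesianProduct (winning a) (losing a))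
      ≤⟨ Unique-⊆⇒length≤ (UniqueP.cartesianProduct⁺ (filter-unique (winsOnTop? a))
           (filter-unique (¬? ∘ winsOnTop? a))) covered ⟩
    length cover
      ≡⟨ length-cartesianProductWith _ allSplits (nearby a) ⟩
    length allSplits * length (nearby a)
      ≤⟨ ℕP.*-monoˡ-≤ (length (nearby a)) (length-concatMap≤ (splits [] ∘ word) (K * K)
           (λ ρ → subst (_≤ K * K) (sym (length-splits [] (word ρ))) (length-word ρ)) (rankings K)) ⟩
    N * (K * K) * length (nearby a) ∎
    where
    open ℕP.≤-Reasoning
    allSplits : List (List ℕ × List ℕ)
    allSplits = concatMap (splits [] ∘ word) (rankings K)
    cover : List (Ranking × Ranking)
    cover = cartesianProductWith (λ s ρ → act (proj₁ s) ρ , act (proj₂ s) ρ) allSplits (nearby a)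
    covered : cartesianProduct (winning a) (losing a) ⊆ cover
    covered {σ , τ} στ∈ with Mem.∈-cartesianProduct⁻ (winning a) (losing a) στ∈
    ... | σ∈ , τ∈ with Mem.∈-filter⁻ (winsOnTop? a) {xs = rankings K} σ∈
                     | Mem.∈-filter⁻ (¬? ∘ winsOnTop? a) {xs = rankings K} τ∈
    ... | σ∈R , wins | τ∈R , ¬wins
      with word-between σ τ (∈-rankings⁻ σ∈R) (∈-rankings⁻ τ∈R)
    ... | ρ , ρ∈ , refl with crossing (winsOnTop? a) [] (word ρ) (∈-rankings⁻ σ∈R) wins ¬wins
    ... | s , s∈ , ρ′ , u′ , ¬wins′ , (i , wins′) , back , forth =
      subst (_∈ cover) (cong₂ _,_ back forth)
        (Mem.∈-cartesianProductWith⁺ _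
          (Mem.∈-concatMap⁺ (splits [] ∘ word) (Any.map (λ { refl → s∈ }) ρ∈))
          (boundary a i u′ ¬wins′ wins′))

  chosen-covered : ∀ a → chosen a ⊆ winning a ++ nearby a
  chosen-covered a {σ} σ∈ with Mem.∈-filter⁻ (λ σ → f σ Fin.≟ a) {xs = rankings K} σ∈
  ... | σ∈R , eq with split-at a σ (∈-rankings⁻ σ∈R)
  ... | p , v , refl with climb a v (to-top p (∈-rankings⁻ σ∈R)) p (inj₁ eq)
  ... | inj₁ same = Mem.∈-++⁺ˡ
    (Mem.∈-filter⁺ (winsOnTop? a) σ∈R (winsOnTop⁺ p (trans same eq)))
  ... | inj₂ (q , hit) = Mem.∈-++⁺ʳ (winning a) (∈-nearby p q hit)

  beaten-covered : ∀ a → beaten a ⊆ losing a ++ nearby a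
  beaten-covered a {σ} σ∈ with Mem.∈-filter⁻ (λ σ → above? σ a (f σ)) {xs = rankings K} σ∈
  ... | σ∈R , above with split-at a σ (∈-rankings⁻ σ∈R)
  ... | p , v , refl with climb a v (to-top p (∈-rankings⁻ σ∈R)) p (inj₂ above)
  ... | inj₁ same = Mem.∈-++⁺ˡ (Mem.∈-filter⁺ (¬? ∘ winsOnTop? a) σ∈R (loses above))
    where
    -- If `a` won on top, the unchanged outcome would be `a` itself, and `a` would stand above
    -- itself.
    loses : Above (insertAt v p a) a (f (insertAt v p a)) → ¬ WinsOnTop a (insertAt v p a)
    loses (i , j , i<j , eqᵢ , eqⱼ) wins =
      FinP.<⇒≢ i<j (lookup-injective (insertAt v p a) (∈-rankings⁻ σ∈R)
      (trans eqᵢ (sym (trans eqⱼ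
        (trans (sym same) (winsOnTop⁻ p (∈-rankings⁻ σ∈R) wins))))))
  ... | inj₂ (q , hit) = Mem.∈-++⁺ʳ (losing a) (∈-nearby p q hit)

-- The functions top_H.

first : {P : A → Set} → (∀ x → Dec (P x)) → A → Vec A n → A
first P? d [] = d
first P? d (x ∷ v) with P? x
... | yes _ = x
... | no _ = first P? d v

first-precedes : {P : A → Set} (P? : ∀ x → Dec (P x)) (d : A) (v : Vec A n) {y : A} → y ∈ᵥ v → P y →
                 P (first P? d v) × (y ≡ first P? d v ⊎ Precedes (first P? d v) y v)
first-precedes P? d (x ∷ v) y∈ py with P? x
first-precedes P? d (x ∷ v) (here refl) py | yes px = px , inj₁ refl
first-precedes P? d (x ∷ v) (there y∈v) py | yes px = px , inj₂ (here y∈v)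
first-precedes P? d (x ∷ v) (here refl) py | no ¬px = contradiction py ¬px
first-precedes P? d (x ∷ v) (there y∈v) py | no ¬px with first-precedes P? d v y∈v py
... | p , inj₁ eq = p , inj₁ eq
... | p , inj₂ prec = p , inj₂ (there prec)

-- The default `zero` arises only when no entry lies in `H`, which cannot happen on a ranking with
-- `H` nonempty.
topOf : Subset (suc k) → SCF (suc k)
topOf H = first (SubsetP._∈? H) zero

topOf-isTop : {H : Subset (suc k)} → Nonempty H → ∀ σ → IsRanking σ → IsTop H σ (topOf H σ)
topOf-isTop {k} {H} (h , h∈H) σ u =
  proj₁ (first-precedes (SubsetP._∈? H) zero σ (occurs h) h∈H) , above
  where
  occurs : ∀ x → x ∈ᵥ σ
  occurs x with ranking-surjective σ u x
  ... | i , refl = VecM.∈-lookup i σ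
  above : ∀ y → y ∈ₛ H → y ≢ topOf H σ → Above σ (topOf H σ) y
  above y y∈H y≢ with proj₂ (first-precedes (SubsetP._∈? H) zero σ (occurs y) y∈H)
  ... | inj₁ eq = contradiction eq y≢
  ... | inj₂ prec = Precedes⇒Above prec

topOf-nonmanip : {H : Subset (suc k)} → Nonempty H → NONMANIP (topOf H)
topOf-nonmanip {H = H} ne = inj₁ (H , ne , λ σ σ∈ → topOf-isTop ne σ (∈-rankings⁻ σ∈))

-- Inequalities between the counts.

-- Here `c` and `c′` are the sizes of C and its complement, `e` that of `nearby a`, and `q` is
-- `K * K`. Each of the four terms of (c + e)(c′ + e) is at most N q e.
square-from-product-bound : ∀ {c c′ e q t : ℕ} N → 1 ≤ q → t ≤ c + e → t ≤ c′ + e → c * c′ ≤ N * q * e →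
              c ≤ N → c′ ≤ N → e ≤ N * q → t * t ≤ 4 * (N * q * e)
square-from-product-bound {c} {c′} {e} {q} {t} N 1≤q t≤ t≤′ cc′ c≤ c′≤ e≤ = begin
  t * t                             ≤⟨ ℕP.*-mono-≤ t≤ t≤′ ⟩
  (c + e) * (c′ + e)                ≡⟨ expand c c′ e ⟩
  c * c′ + (c * e + (c′ * e + e * e)) ≤⟨ ℕP.+-mono-≤ cc′ (ℕP.+-mono-≤ (linear c≤)
                                         (ℕP.+-mono-≤ (linear c′≤) (ℕP.*-monoˡ-≤ e e≤))) ⟩
  N * q * e + (N * q * e + (N * q * e + N * q * e)) ≡⟨ collect (N * q * e) ⟩
  4 * (N * q * e)                   ∎
  where
  open ℕP.≤-Reasoning
  expand : ∀ c c′ e → (c + e) * (c′ + e) ≡ c * c′ + (c * e + (c′ * e + e * e))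
  expand = solve-∀
  collect : ∀ x → x + (x + (x + x)) ≡ 4 * x
  collect = solve-∀
  linear : ∀ {x} → x ≤ N → x * e ≤ N * q * e
  linear {x} x≤ = ℕP.*-monoˡ-≤ e (ℕP.≤-trans (ℕP.≤-reflexive (sym (ℕP.*-identityʳ x)))
    (ℕP.*-mono-≤ x≤ 1≤q))

-- Serves to bound the union of all error sets by `K` times the largest one.
longest : (g : Fin (suc k) → List B) →
          ∃ λ i → length (concatMap g (List.allFin (suc k))) ≤ suc k * length (g i)
longest {k} g = i , subst (λ l → length (concatMap g (List.allFin (suc k))) ≤ l * length (g i))
  (ListP.length-tabulate {n = suc k} id)
  (length-concatMap≤ g (length (g i)) (λ j → All.lookup maximal (Mem.∈-allFin j)) (List.allFin (suc k)))
  where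
  i : Fin (suc k)
  i = argmax (length ∘ g) zero (List.allFin (suc k))
  maximal : All (λ j → length (g j) ≤ length (g i)) (List.allFin (suc k))
  maximal = f[xs]≤f[argmax] zero (List.allFin (suc k))

square-bound : ∀ k M N {t T} → T ≤ k * t → t * t ≤ 4 * (N * (k * k) * (M * (k * k))) →
               T * T ≤ 4 * k ^ 6 * (M * N)
square-bound k M N {t} {T} T≤ t² = begin
  T * T                                       ≤⟨ ℕP.*-mono-≤ T≤ T≤ ⟩
  k * t * (k * t)                             ≡⟨ regroup k t ⟩
  k * k * (t * t)                             ≤⟨ ℕP.*-monoʳ-≤ (k * k) t² ⟩
  k * k * (4 * (N * (k * k) * (M * (k * k)))) ≡⟨ powers k M N ⟩
  4 * k ^ 6 * (M * N)                         ∎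
  where
  open ℕP.≤-Reasoning
  regroup : ∀ k t → k * t * (k * t) ≡ k * k * (t * t)
  regroup = solve-∀
  -- The nested product is `k ^ 6` unfolded.
  powers : ∀ k M N → k * k * (4 * (N * (k * k) * (M * (k * k)))) ≡
                     4 * (k * (k * (k * (k * (k * (k * 1)))))) * (M * N)
  powers = solve-∀

-- Two factors `d` use the square bound and the third uses `d ≤ N`: this is ε³ ≤ ε² with
-- denominators cleared.
cube-bound : ∀ {d t} M N c X → c ≤ X → d ≤ t → d ≤ N → t * t ≤ c * (M * N) →
             d * d * d ≤ M * N * N * X
cube-bound {d} {t} M N c X c≤X d≤t d≤N t² = begin
  d * d * d       ≤⟨ ℕP.*-mono-≤ (ℕP.≤-trans (ℕP.*-mono-≤ d≤t d≤t) t²) d≤N ⟩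
  c * (M * N) * N ≤⟨ ℕP.*-monoˡ-≤ N (ℕP.*-monoˡ-≤ (M * N) c≤X) ⟩
  X * (M * N) * N ≡⟨ shuffle X M N ⟩
  M * N * N * X   ∎
  where
  open ℕP.≤-Reasoning
  shuffle : ∀ X M N → X * (M * N) * N ≡ M * N * N * X
  shuffle = solve-∀

constants : ∀ k .{{_ : NonZero k}} → 4 * k ^ 6 ≤ 10 ^ 5 * k ^ 16
constants k = ℕP.*-mono-≤ {4} {10 ^ 5} (ℕP.≤ᵇ⇒≤ 4 (10 ^ 5) tt)
  (ℕP.^-monoʳ-≤ k {6} {16} (ℕP.≤ᵇ⇒≤ 6 16 tt))

-- Approximation by some top_H.

module Approximation {k : ℕ} (f : SCF (suc k)) where

  open Voter f

  Kept : Fin K → Set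
  Kept a = length (beaten a) ≤ length (chosen a)

  kept? : ∀ a → Dec (Kept a)
  kept? a = length (beaten a) ≤? length (chosen a)

  -- The price of the decision on `a`: keeping it in `H` risks `beaten a`, leaving it out risks
  -- `chosen a`. The cheaper option is taken, so both bounds apply to its size.
  errors : Fin K → List Ranking
  errors a with kept? a
  ... | yes _ = beaten a
  ... | no _ = chosen a

  errors≤beaten : ∀ a → length (errors a) ≤ length (beaten a)
  errors≤beaten a with kept? a
  ... | yes _ = ℕP.≤-refl
  ... | no ¬kept = ℕP.<⇒≤ (ℕP.≰⇒> ¬kept)

  errors≤chosen : ∀ a → length (errors a) ≤ length (chosen a)
  errors≤chosen a with kept? a
  ... | yes kept = kept
  ... | no _ = ℕP.≤-refl

  filter≤N : {P : Ranking → Set} (P? : ∀ σ → Dec (P σ)) → length (filter P? (rankings K)) ≤ N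
  filter≤N P? = ListP.length-filter P? (rankings K)

  errors² : ∀ a → length (errors a) * length (errors a) ≤ 4 * (N * (K * K) * (M * (K * K)))
  errors² a = subst (λ e → length (errors a) * length (errors a) ≤ 4 * (N * (K * K) * e))
    (length-nearby a)
    (square-from-product-bound N (s≤s z≤n)
      (bound (filter-unique (λ σ → f σ Fin.≟ a)) (winning a) (chosen-covered a) (errors≤chosen a))
      (bound (filter-unique (λ σ → above? σ a (f σ))) (losing a) (beaten-covered a) (errors≤beaten a))
      (isoperimetry a) (filter≤N (winsOnTop? a)) (filter≤N (¬? ∘ winsOnTop? a))
      (subst (_≤ N * (K * K)) (sym (length-nearby a))
        (ℕP.*-monoˡ-≤ (K * K) (filter≤N (manipPointR? 3 f)))))
    where
    bound : ∀ {t xs} → Unique xs → ∀ ys → xs ⊆ ys ++ nearby a → t ≤ length xs →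
            t ≤ length ys + length (nearby a)
    bound u ys sub t≤ = ℕP.≤-trans t≤
      (ℕP.≤-trans (Unique-⊆⇒length≤ u sub) (ℕP.≤-reflexive (ListP.length-++ ys)))

  allErrors : List Ranking
  allErrors = concatMap errors (List.allFin K)

  ∈-allErrors : ∀ {σ} a → σ ∈ errors a → σ ∈ allErrors
  ∈-allErrors a σ∈ = Mem.∈-concatMap⁺ errors (Any.map (λ { refl → σ∈ }) (Mem.∈-allFin a))

  rejected-choice : ∀ {σ} → σ ∈ rankings K → ¬ Kept (f σ) → σ ∈ allErrors
  rejected-choice {σ} σ∈ ¬kept = ∈-allErrors (f σ) member
    where
    member : σ ∈ errors (f σ)
    member with kept? (f σ)
    ... | yes kept = contradiction kept ¬kept
    ... | no _ = Mem.∈-filter⁺ (λ τ → f τ Fin.≟ f σ) σ∈ refl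

  beaten-choice : ∀ {σ} a → σ ∈ rankings K → Kept a → Above σ a (f σ) → σ ∈ allErrors
  beaten-choice {σ} a σ∈ kept above = ∈-allErrors a member
    where
    member : σ ∈ errors a
    member with kept? a
    ... | yes _ = Mem.∈-filter⁺ (λ τ → above? τ a (f τ)) σ∈ above
    ... | no ¬kept = contradiction kept ¬kept

  H : Subset K
  H = tabulate (does ∘ kept?)

  ∈H⁺ : ∀ a → Kept a → a ∈ₛ H
  ∈H⁺ a kept = VecP.lookup⇒[]= a H (trans (VecP.lookup∘tabulate (does ∘ kept?) a) (dec-true (kept? a) kept))

  ∈H⁻ : ∀ a → a ∈ₛ H → Kept a
  ∈H⁻ a a∈H = does⇒ (kept? a)
    (trans (sym (VecP.lookup∘tabulate (does ∘ kept?) a)) (VecP.[]=⇒lookup a∈H))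
    where
    does⇒ : {P : Set} (P? : Dec P) → does P? ≡ true → P
    does⇒ (yes p) _ = p

  disagreements : SCF K → List Ranking
  disagreements g = filter (λ σ → ¬? (f σ Fin.≟ g σ)) (rankings K)

  ∈-disagreements⁻ : ∀ g {σ} → σ ∈ disagreements g → σ ∈ rankings K × f σ ≢ g σ
  ∈-disagreements⁻ g σ∈ = Mem.∈-filter⁻ (λ σ → ¬? (f σ Fin.≟ g σ)) {xs = rankings K} σ∈

  -- With `H` empty every outcome is rejected, so every ranking is already an error and any
  -- approximant will do.
  empty-covered : ¬ Nonempty H → ∀ g → disagreements g ⊆ allErrors
  empty-covered empty g {σ} σ∈ = rejected-choice (proj₁ (∈-disagreements⁻ g σ∈))
    (λ kept → empty (f σ , ∈H⁺ (f σ) kept))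

  -- If `f σ` is outside `H`, then `σ` is an error of `f σ`. If it is inside but not the top, the
  -- top of `H` stands above it and `σ` is an error of that top.
  topOf-covered : Nonempty H → disagreements (topOf H) ⊆ allErrors
  topOf-covered ne {σ} σ∈ = go (∈-disagreements⁻ (topOf H) σ∈) (kept? (f σ))
    where
    go : σ ∈ rankings K × f σ ≢ topOf H σ → Dec (Kept (f σ)) → σ ∈ allErrors
    go (σ∈R , _) (no ¬kept) = rejected-choice σ∈R ¬kept
    go (σ∈R , f≢g) (yes kept) = beaten-choice (topOf H σ) σ∈R (∈H⁻ (topOf H σ) (proj₁ isTop))
      (proj₂ isTop (f σ) (∈H⁺ (f σ) kept) f≢g)
      where
      isTop : IsTop H σ (topOf H σ)
      isTop = topOf-isTop ne σ (∈-rankings⁻ σ∈R)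

  approximant : ∃ λ g → NONMANIP g × disagreements g ⊆ allErrors
  approximant = choose (SubsetP.nonempty? H)
    where
    choose : Dec (Nonempty H) → ∃ λ g → NONMANIP g × disagreements g ⊆ allErrors
    choose (yes ne) = topOf H , topOf-nonmanip {H = H} ne , topOf-covered ne
    -- An arbitrary nonempty set.
    choose (no empty) = topOf ⁅ zero ⁆ , topOf-nonmanip {H = ⁅ zero ⁆} (zero , SubsetP.x∈⁅x⁆ zero) ,
      empty-covered empty (topOf ⁅ zero ⁆)

  disagreements³ : ∀ {g} → disagreements g ⊆ allErrors →
    length (disagreements g) * length (disagreements g) * length (disagreements g)
      ≤ M * N * N * (10 ^ 5 * K ^ 16)
  disagreements³ {g} sub = cube-bound M N (4 * K ^ 6) (10 ^ 5 * K ^ 16) (constants K)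
    (Unique-⊆⇒length≤ (filter-unique λ σ → ¬? (f σ Fin.≟ g σ)) sub)
    (filter≤N λ σ → ¬? (f σ Fin.≟ g σ))
    (square-bound K M N (proj₂ (longest errors)) (errors² (proj₁ (longest errors))))

-- From counts to rational probabilities.

-- Unnormalised fractions keep numerator and denominator in view, so comparisons become
-- cross-multiplications of integers.
toℚᵘ-/ : ∀ a b → Q.toℚᵘ ((+ a) Q./ suc b) Qᵘ.≃ mkℚᵘ (+ a) b
toℚᵘ-/ a b = QP.toℚᵘ-fromℚᵘ (mkℚᵘ (+ a) b)

ratio-mono : ∀ {a a′} b → a ≤ a′ → ratio a b Q.≤ ratio a′ b
ratio-mono zero _ = QP.≤-refl
ratio-mono {a} {a′} (suc b) a≤a′ = QP.toℚᵘ-cancel-≤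
  (QᵘP.≤-respˡ-≃ (QᵘP.≃-sym (toℚᵘ-/ a b)) (QᵘP.≤-respʳ-≃ (QᵘP.≃-sym (toℚᵘ-/ a′ b))
    (*≤* (ℤP.*-monoʳ-≤-nonNeg (+ suc b) (ℤ.+≤+ a≤a′)))))

ratio-nonNeg : ∀ a b → Q.NonNegative (ratio a b)
ratio-nonNeg a zero = _
ratio-nonNeg a (suc b) = QP.normalize-nonNeg a (suc b)

*-mono-nonNeg : ∀ {p q r s} → Q.NonNegative p → Q.NonNegative s → p Q.≤ q → r Q.≤ s →
                p Q.* r Q.≤ q Q.* s
*-mono-nonNeg {p} {q} {r} {s} p≥0 s≥0 p≤q r≤s =
  QP.≤-trans (QP.*-monoˡ-≤-nonNeg p {{p≥0}} r≤s) (QP.*-monoʳ-≤-nonNeg s {{s≥0}} p≤q)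

cube-ratio : ∀ d m n x → d * d * d ≤ m * n * n * x →
             ratio d n Q.* ratio d n Q.* ratio d n Q.* ratio 1 x Q.≤ ratio m n
-- A `ratio` with denominator zero is zero, so the left side vanishes in both degenerate cases.
cube-ratio d m zero x _ = QP.≤-reflexive (QP.*-zeroˡ (ratio 1 x))
cube-ratio d m n@(suc _) zero _ = QP.≤-trans
  (QP.≤-reflexive (QP.*-zeroʳ (ratio d n Q.* ratio d n Q.* ratio d n)))
  (QP.nonNegative⁻¹ (ratio m n) {{ratio-nonNeg m n}})
cube-ratio d m (suc n) (suc x) le = QP.toℚᵘ-cancel-≤
  (QᵘP.≤-respˡ-≃ (QᵘP.≃-sym expand) (QᵘP.≤-respʳ-≃ (QᵘP.≃-sym (toℚᵘ-/ m n)) (*≤* cross)))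
  where
  r s : Q.ℚ
  r = ratio d (suc n)
  s = ratio 1 (suc x)
  r′ s′ : ℚᵘ
  r′ = mkℚᵘ (+ d) n
  s′ = mkℚᵘ (+ 1) x
  expand : Q.toℚᵘ (r Q.* r Q.* r Q.* s) Qᵘ.≃ r′ Qᵘ.* r′ Qᵘ.* r′ Qᵘ.* s′
  expand = QᵘP.≃-trans (QP.toℚᵘ-homo-* (r Q.* r Q.* r) s) (QᵘP.*-cong
    (QᵘP.≃-trans (QP.toℚᵘ-homo-* (r Q.* r) r) (QᵘP.*-cong
      (QᵘP.≃-trans (QP.toℚᵘ-homo-* r r) (QᵘP.*-cong (toℚᵘ-/ d n) (toℚᵘ-/ d n)))
      (toℚᵘ-/ d n)))
    (toℚᵘ-/ 1 x))
  natural : d * d * d * 1 * suc n ≤ m * (suc n * suc n * suc n * suc x)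
  natural = ℕP.≤-trans
    (ℕP.*-monoˡ-≤ (suc n) (ℕP.≤-trans (ℕP.≤-reflexive (ℕP.*-identityʳ (d * d * d))) le))
    (ℕP.≤-reflexive (shuffle m (suc n) (suc x)))
    where
    shuffle : ∀ m n x → m * n * n * x * n ≡ m * (n * n * n * x)
    shuffle = solve-∀
  numerator : (+ d) ℤ.* (+ d) ℤ.* (+ d) ℤ.* (+ 1) ℤ.* (+ suc n) ≡ + (d * d * d * 1 * suc n)
  numerator = sym (trans (ℤP.pos-* (d * d * d * 1) (suc n)) (cong (ℤ._* (+ suc n))
    (trans (ℤP.pos-* (d * d * d) 1) (cong (ℤ._* (+ 1))
      (trans (ℤP.pos-* (d * d) d) (cong (ℤ._* (+ d)) (ℤP.pos-* d d)))))))
  cross : (+ d) ℤ.* (+ d) ℤ.* (+ d) ℤ.* (+ 1) ℤ.* (+ suc n) ℤ.≤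
          (+ m) ℤ.* (+ (suc n * suc n * suc n * suc x))
  cross = subst (ℤ._≤ _) (sym numerator)
    (subst (_ ℤ.≤_) (ℤP.pos-* m (suc n * suc n * suc n * suc x)) (ℤ.+≤+ natural))

cube-lower-bound : ∀ {ε} d m n x → Q.0ℚ Q.< ε → ε Q.≤ ratio d n → d * d * d ≤ m * n * n * x →
                   ε Q.* ε Q.* ε Q.* ratio 1 x Q.≤ ratio m n
cube-lower-bound {ε} d m n x 0<ε ε≤r le = QP.≤-trans
  (QP.*-monoʳ-≤-nonNeg (ratio 1 x) {{ratio-nonNeg 1 x}}
    (*-mono-nonNeg {p = ε Q.* ε} εε≥0 r≥0 (*-mono-nonNeg {p = ε} ε≥0 r≥0 ε≤r ε≤r) ε≤r))
  (cube-ratio d m n x le)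
  where
  r≥0 : Q.NonNegative (ratio d n)
  r≥0 = ratio-nonNeg d n
  ε≥0 : Q.NonNegative ε
  ε≥0 = Q.nonNegative (QP.<⇒≤ 0<ε)
  εε≥0 : Q.NonNegative (ε Q.* ε)
  εε≥0 = Q.nonNegative (QP.≤-trans (QP.≤-reflexive (sym (QP.*-zeroʳ ε)))
    (QP.*-monoˡ-≤-nonNeg ε {{ε≥0}} (QP.<⇒≤ 0<ε)))

-- Conclusion.

M₃⊆M : (f : SCF (suc k)) → Voter.manipulable f ⊆ filter (manipPoint? f) (rankings (suc k))
M₃⊆M {k} f {σ} σ∈ with Mem.∈-filter⁻ (manipPointR? 3 f) {xs = rankings (suc k)} σ∈
... | σ∈R , manip = Mem.∈-filter⁺ (manipPoint? f) σ∈R (Any.map proj₂ manip)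

theorem1p4 : (k : ℕ) → 3 ≤ k → (ε : Q.ℚ) → Q.0ℚ Q.< ε → (f : SCF k) →
    (∀ (g : SCF k) → NONMANIP g → ε Q.≤ dist f g) →
    (probManipR 3 f Q.≤ probManip f)
    × (ε Q.* ε Q.* ε Q.* ratio 1 (10 ^ 5 * k ^ 16) Q.≤ probManipR 3 f)
theorem1p4 k@(suc _) _ ε 0<ε f far =
  ratio-mono N (Unique-⊆⇒length≤ (filter-unique (manipPointR? 3 f)) (M₃⊆M f)) ,
  lower-bound approximant
  where
  open Voter f
  open Approximation f
  lower-bound : (∃ λ g → NONMANIP g × disagreements g ⊆ allErrors) →
                ε Q.* ε Q.* ε Q.* ratio 1 (10 ^ 5 * k ^ 16) Q.≤ probManipR 3 f
  -- `dist f g` unfolds to the ratio of `length (disagreements g)` to `N`, so `far` bounds ε by that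
  -- ratio.
  lower-bound (g , nonmanip , sub) = cube-lower-bound (length (disagreements g)) M N
    (10 ^ 5 * k ^ 16) 0<ε (far g nonmanip) (disagreements³ {g} sub)
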